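{- For every integer $n\geq 4$, the pancake graph $P_n$ is hyper-connected; that is, for every minimum vertex cut $D$ of $P_n$, the graph $P_n-D$ has exactly two connected components, one of which is an isolated vertex.
   Context: For $n\ge 2$ and $2\leq j\leq n$, let $r_{1j}\in S_n$ be the prefix reversal, i.e. the permutation of $\{1,\dots,n\}$ with $r_{1j}(k)=j+1-k$ for $1\leq k\leq j$ and $r_{1j}(k)=k$ for $j<k\leq n$. Let $PR_n=\{r_{1j}: 2\leq j\leq n\}$. The pancake graph $P_n$ is the Cayley graph $\mathrm{Cay}(S_n,PR_n)$: the simple undirected graph with vertex set the symmetric group $S_n$ and edges $\{g,gs\}$ for $g\in S_n$, $s\in PR_n$, where products of permutations are composed as $(gs)(k)=g(s(k))$. A graph $X$ is hyper-connected if for every minimum vertex cut $D$ of $X$ (a vertex set of minimum cardinality whose removal disconnects $X$), $X-D$ has exactly two components, one of which is an isolated vertex. -}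

module Defs where

open import Algebra.Bundles using (Group)
open import Data.Fin.Base using (Fin; zero; toℕ; fromℕ<)
open import Data.Fin.Permutation as Perm
  using (Permutation′; permutation; _⟨$⟩ʳ_; _⟨$⟩ˡ_; _∘ₚ_; flip; inverseˡ; inverseʳ)
open import Data.Fin.Properties using (toℕ-fromℕ<; toℕ-injective)
open import Data.List.Base using (List; length)
open import Data.Nat.Base using (ℕ; suc; _∸_; _≤_; _<_; z≤n; s≤s)
open import Data.Nat.Properties
  using (_<?_; <-≤-trans; ∸-monoʳ-<; m∸[m∸n]≡n)
open import Data.Product.Base using (Σ; ∃₂; _×_; _,_; proj₁; proj₂)
open import Data.Sum.Base using (_⊎_)
open import Function.Base using (_on_)
open import Level using (Level; 0ℓ; _⊔_) renaming (suc to ℓsuc)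
open import Relation.Binary.Bundles using (Setoid)
open import Relation.Binary.Core using (Rel)
open import Relation.Binary.Definitions using (Symmetric; _Respects_; _Respects₂_)
import Relation.Binary.Construct.On as On
open import Relation.Binary.PropositionalEquality.Core
  using (_≡_; refl; sym; trans; cong; subst)
open import Relation.Nullary.Decidable.Core using (Dec; yes; no)
open import Relation.Nullary.Negation.Core using (¬_; contradiction)
open import Relation.Unary using (Pred; _∈_; _≐_)
import Data.List.Membership.Setoid as Membership
import Data.List.Relation.Unary.Unique.Setoid as Uniqueness

private
  variable
    c ℓ a p : Level

-- Simple undirected graphs. Vertices form a setoid, because permutations are
-- compared pointwise rather than by _≡_.
record Graph c ℓ a : Set (ℓsuc (c ⊔ ℓ ⊔ a)) where
  field
    vertices : Setoid c ℓ

  open Setoid vertices public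
    using (_≈_) renaming (Carrier to Vertex; refl to ≈-refl; sym to ≈-sym; trans to ≈-trans)

  field
    Adj      : Rel Vertex a
    Adj-resp : Adj Respects₂ _≈_
    Adj-sym  : Symmetric Adj
    loopless : ∀ {u v} → u ≈ v → ¬ Adj u v

module _ (X : Graph c ℓ a) where
  open Graph X
  open Membership vertices using (_∉_)
  open Uniqueness vertices using (Unique)

  -- Finite vertex sets, listed without repetition so that the length of the
  -- list is the cardinality of the set.
  record VertexSet : Set (c ⊔ ℓ) where
    field
      elements : List Vertex
      unique   : Unique elements

    card : ℕ
    card = length elements

  data Walk : Rel Vertex (c ⊔ ℓ ⊔ a) where
    stay : ∀ {u v} → u ≈ v → Walk u v
    step : ∀ {u v w} → Adj u v → Walk v w → Walk u w

  -- The connected component containing a vertex.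
  component : Vertex → Pred Vertex (c ⊔ ℓ ⊔ a)
  component v = Walk v

  Disconnected : Set (c ⊔ ℓ ⊔ a)
  Disconnected = ∃₂ λ u v → ¬ Walk u v

  ExactlyTwoComponentsOneIsolated : Set (c ⊔ ℓ ⊔ a)
  ExactlyTwoComponentsOneIsolated = ∃₂ λ u v →
      ¬ (component u ≐ component v)
    × (∀ w → component w ≐ component u ⊎ component w ≐ component v)
    × (isolatedVertex (component u) ⊎ isolatedVertex (component v))
    where
    isolatedVertex : Pred Vertex (c ⊔ ℓ ⊔ a) → Set (c ⊔ ℓ ⊔ a)
    isolatedVertex C = Σ Vertex λ x → C ≐ (x ≈_)

-- X ─ D is the subgraph induced on the complement of D.
infixl 6 _─_

_─_ : (X : Graph c ℓ a) → VertexSet X → Graph (c ⊔ ℓ) ℓ a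
X ─ D = record
  { vertices = record
      { Carrier       = Σ Vertex (_∉ VertexSet.elements D)
      ; _≈_           = _≈_ on proj₁
      ; isEquivalence = On.isEquivalence proj₁ (Setoid.isEquivalence vertices)
      }
  ; Adj      = Adj on proj₁
  ; Adj-resp = (λ {x} → proj₁ Adj-resp {proj₁ x}) , (λ {x} → proj₂ Adj-resp {proj₁ x})
  ; Adj-sym  = Adj-sym
  ; loopless = loopless
  }
  where
  open Graph X
  open Membership vertices using (_∉_)

module _ (X : Graph c ℓ a) where

  VertexCut : VertexSet X → Set (c ⊔ ℓ ⊔ a)
  VertexCut D = Disconnected (X ─ D)

  MinimumVertexCut : VertexSet X → Set (c ⊔ ℓ ⊔ a)
  MinimumVertexCut D =
    VertexCut D × (∀ D′ → VertexCut D′ → VertexSet.card D ≤ VertexSet.card D′)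

  HyperConnected : Set (c ⊔ ℓ ⊔ a)
  HyperConnected = ∀ D → MinimumVertexCut D → ExactlyTwoComponentsOneIsolated (X ─ D)

module _ (G : Group c ℓ) where
  open Group G renaming (refl to ≈-refl; sym to ≈-sym; trans to ≈-trans)

  Cay : (S : Pred Carrier p) → S Respects _≈_ →
        (∀ {s} → s ∈ S → s ⁻¹ ∈ S) → ¬ (ε ∈ S) → Graph c ℓ (c ⊔ ℓ ⊔ p)
  Cay S S-resp S-inv ε∉S = record
    { vertices = setoid
    ; Adj      = λ g h → Σ Carrier λ s → s ∈ S × h ≈ g ∙ s
    ; Adj-resp = (λ h≈h′ (s , s∈S , e) → s , s∈S , ≈-trans (≈-sym h≈h′) e)
               , (λ g≈g′ (s , s∈S , e) → s , s∈S , ≈-trans e (∙-congʳ g≈g′))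
    ; Adj-sym  = λ {g} {h} (s , s∈S , e) → s ⁻¹ , S-inv s∈S ,
        ≈-sym (≈-trans (∙-congʳ e) (≈-trans (assoc g s (s ⁻¹))
          (≈-trans (∙-congˡ (inverseʳ′ s)) (identityʳ g))))
    ; loopless = λ {g} {h} g≈h (s , s∈S , e) → ε∉S (S-resp
        (≈-trans (≈-sym (identityˡ s)) (≈-trans (∙-congʳ (≈-sym (inverseˡ′ g)))
          (≈-trans (assoc (g ⁻¹) g s)
            (≈-trans (∙-congˡ (≈-trans (≈-sym e) (≈-sym g≈h))) (inverseˡ′ g))))) s∈S)
    }
    where
    inverseʳ′ = Group.inverseʳ G
    inverseˡ′ = Group.inverseˡ G

-- _∘ₚ_ composes diagrammatically, so its arguments are swapped to obtain
-- (g ∙ h)(k) = g(h(k)).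
SymmetricGroup : ℕ → Group 0ℓ 0ℓ
SymmetricGroup n = record
  { Carrier = Permutation′ n
  ; _≈_     = Perm._≈_
  ; _∙_     = λ g h → h ∘ₚ g
  ; ε       = Perm.id
  ; _⁻¹     = flip
  ; isGroup = record
    { isMonoid = record
      { isSemigroup = record
        { isMagma = record
          { isEquivalence = record
            { refl  = λ _ → refl
            ; sym   = λ e k → sym (e k)
            ; trans = λ e f k → trans (e k) (f k)
            }
          ; ∙-cong = λ {g} {g′} {h} {h′} e f k →
              trans (e (h ⟨$⟩ʳ k)) (cong (g′ ⟨$⟩ʳ_) (f k))
          }
        ; assoc = λ _ _ _ _ → refl
        }
      ; identity = (λ _ _ → refl) , (λ _ _ → refl)
      }
    ; inverse = (λ g _ → inverseˡ g) , (λ g _ → inverseʳ g)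
    ; ⁻¹-cong = λ {g} {h} → flip-cong g h
    }
  }
  where
  flip-cong : (g h : Permutation′ n) → g Perm.≈ h → flip g Perm.≈ flip h
  flip-cong g h e k = trans
    (cong (g ⟨$⟩ˡ_) (sym (trans (e (h ⟨$⟩ˡ k)) (inverseʳ h))))
    (inverseˡ g)

-- The points 1, …, n are represented by 0, …, n - 1, so k ↦ j + 1 - k becomes
-- k ↦ j - (k + 1).
reversePrefix : ∀ {n} j → j ≤ n → Fin n → Fin n
reversePrefix j j≤n k with toℕ k <? j
... | yes k<j = fromℕ< (<-≤-trans (∸-monoʳ-< {j} {suc (toℕ k)} {0} (s≤s z≤n) k<j) j≤n)
... | no  _   = k

reversePrefix-< : ∀ {n} j (j≤n : j ≤ n) k → toℕ k < j →
                  toℕ (reversePrefix j j≤n k) ≡ j ∸ suc (toℕ k)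
reversePrefix-< j j≤n k k<j with toℕ k <? j
... | yes _   = toℕ-fromℕ< _
... | no  k≮j = contradiction k<j k≮j

reversePrefix-≮ : ∀ {n} j (j≤n : j ≤ n) k → ¬ (toℕ k < j) → reversePrefix j j≤n k ≡ k
reversePrefix-≮ j j≤n k k≮j with toℕ k <? j
... | yes k<j = contradiction k<j k≮j
... | no  _   = refl

reversePrefix-involutive : ∀ {n} j (j≤n : j ≤ n) k →
                           reversePrefix j j≤n (reversePrefix j j≤n k) ≡ k
reversePrefix-involutive {n} j j≤n k = helper (toℕ k <? j)
  where
  r : Fin n → Fin n
  r = reversePrefix j j≤n

  twice : ∀ j m → m < j → j ∸ suc (j ∸ suc m) ≡ m
  twice (suc j) m (s≤s m≤j) = m∸[m∸n]≡n m≤j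

  helper : Dec (toℕ k < j) → r (r k) ≡ k
  helper (no  k≮j) = trans (cong r (reversePrefix-≮ j j≤n k k≮j)) (reversePrefix-≮ j j≤n k k≮j)
  helper (yes k<j) = toℕ-injective (trans (reversePrefix-< j j≤n (r k) rk<j)
      (trans (cong (λ m → j ∸ suc m) rk≡) (twice j (toℕ k) k<j)))
    where
    rk≡ : toℕ (r k) ≡ j ∸ suc (toℕ k)
    rk≡ = reversePrefix-< j j≤n k k<j

    rk<j : toℕ (r k) < j
    rk<j = subst (_< j) (sym rk≡) (∸-monoʳ-< {j} {suc (toℕ k)} {0} (s≤s z≤n) k<j)

prefixReversal : ∀ {n} j → j ≤ n → Permutation′ n
prefixReversal j j≤n = permutation (reversePrefix j j≤n) (reversePrefix j j≤n)
  (reversePrefix-involutive j j≤n) (reversePrefix-involutive j j≤n)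

PR : ∀ n → Pred (Permutation′ n) 0ℓ
PR n s = Σ ℕ λ j → 2 ≤ j × Σ (j ≤ n) λ j≤n → s Perm.≈ prefixReversal j j≤n

PR-resp : ∀ n → PR n Respects Perm._≈_
PR-resp n e (j , 2≤j , j≤n , f) = j , 2≤j , j≤n , λ k → trans (sym (e k)) (f k)

PR-inv : ∀ n {s} → s ∈ PR n → flip s ∈ PR n
PR-inv n {s} (j , 2≤j , j≤n , f) = j , 2≤j , j≤n , Group.⁻¹-cong (SymmetricGroup n) {s} {prefixReversal j j≤n} f

id∉PR : ∀ n → ¬ (Perm.id ∈ PR n)
id∉PR (suc n) (suc (suc j) , s≤s (s≤s z≤n) , j≤n , f)
  with trans (cong toℕ (f zero)) (reversePrefix-< (suc (suc j)) j≤n zero (s≤s z≤n))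
... | ()

Pancake : ℕ → Graph 0ℓ 0ℓ 0ℓ
Pancake n = Cay (SymmetricGroup n) (PR n)
  (λ {s} {t} → PR-resp n {s} {t}) (λ {s} → PR-inv n {s}) (id∉PR n)

{-# OPTIONS --safe #-}
-- Split the vertices g of P_n into n copies according to the last entry of g.
-- Let |D| ≤ n - 1. Some copy, with last entry c say, contains no element of D,
-- and it is connected. Let x be a vertex of another copy. If x starts with c,
-- then reversing all of x leads into copy c. Otherwise there are n - 2 paths x,
-- x r_j, x r_j r_q (writing r_j for r_{1j}) with 2 ≤ j ≤ n - 1, disjoint apart
-- from x, which stay in the copy of x and whose ends start with c (q is the
-- position of c in x r_j, and the path stops at x r_j if q = 1). Hence x is
-- joined to copy c as soon as its copy contains at most n - 3 elements of D. If
-- some copy contains at least n - 2 elements of D, then at most one element d of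
-- D lies outside that copy, and every vertex of it other than d r_n has a
-- neighbour outside it that is not in D. So at most one vertex is not joined to
-- copy c. A minimum cut has at most n - 1 elements because the neighbours of the
-- identity form a cut.
module Submission where

open import Defs
open import Algebra.Bundles using (Group)
open import Data.Fin.Base using (Fin; zero; suc; toℕ; fromℕ; fromℕ<)
open import Data.Fin.Permutation as Perm
  using (Permutation′; _⟨$⟩ʳ_; _⟨$⟩ˡ_; _∘ₚ_; inverseˡ; inverseʳ)
import Data.Fin.Properties as Fin
open import Data.List.Base using (List; []; _∷_; length; map; filter; tabulate)
open import Data.List.Properties using (length-map; length-tabulate)
open import Data.List.Relation.Unary.Any as Any using (here)
import Data.List.Relation.Unary.Any.Properties as Any
import Data.List.Membership.Setoid as Membership
open import Data.List.Membership.Propositional using (_∈_)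
open import Data.List.Membership.Setoid.Properties using (∈-map⁺; ∈-filter⁺; index-injective)
open import Data.List.Relation.Unary.Unique.Setoid.Properties using (tabulate⁺)
open import Data.Nat.Base using (ℕ; zero; suc; _+_; _∸_; _≤_; _<_; z≤n; s≤s; >-nonZero)
open import Data.Nat.Properties
open import Data.List.Membership.DecPropositional _≟_ using (_∈?_)
open import Data.Product.Base using (Σ; ∃; _×_; _,_; proj₁; proj₂)
open import Data.Sum.Base using (_⊎_; inj₁; inj₂)
open import Relation.Binary.Bundles using (Setoid)
open import Relation.Binary.Definitions using (tri<; tri≈; tri>)
open import Relation.Binary.PropositionalEquality
  using (_≡_; _≢_; refl; sym; trans; cong; cong₂; subst; setoid)
open import Relation.Nullary.Decidable using (Dec; yes; no; ¬?)
open import Relation.Nullary.Negation using (¬_; contradiction)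
open import Relation.Unary using (Pred; Decidable; _≐_)

-- Walks, and graphs in which all vertices but one are joined.

module _ {c ℓ a} (X : Graph c ℓ a) where
  open Graph X

  Walk-respˡ : ∀ {u v w} → u ≈ v → Walk X v w → Walk X u w
  Walk-respˡ u≈v (stay v≈w)   = stay (≈-trans u≈v v≈w)
  Walk-respˡ u≈v (step adj p) = step (proj₂ Adj-resp (≈-sym u≈v) adj) p

  Walk-trans : ∀ {u v w} → Walk X u v → Walk X v w → Walk X u w
  Walk-trans (stay u≈v)   q = Walk-respˡ u≈v q
  Walk-trans (step adj p) q = step adj (Walk-trans p q)

  Walk-sym : ∀ {u v} → Walk X u v → Walk X v u
  Walk-sym (stay u≈v)   = stay (≈-sym u≈v)
  Walk-sym (step adj p) = Walk-trans (Walk-sym p) (step (Adj-sym adj) (stay ≈-refl))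

  componentsOfIsolated : ∀ {p} (E : Pred Vertex p) → Decidable E →
                         (∀ x y → E x → E y → x ≈ y) →
                         (∀ x y → ¬ E x → ¬ E y → Walk X x y) →
                         ∀ u v → E u → ¬ E v → ¬ Walk X u v →
                         ExactlyTwoComponentsOneIsolated X
  componentsOfIsolated E E? unique joined u v Eu ¬Ev ¬uv =
    u , v , (λ eq → ¬uv (proj₂ eq (stay ≈-refl))) , classify , inj₁ (u , isolated , stay)
    where
    same : ∀ {x y} → Walk X x y → component X x ≐ component X y
    same xy = Walk-trans (Walk-sym xy) , Walk-trans xy

    classify : ∀ w → component X w ≐ component X u ⊎ component X w ≐ component X v
    classify w with E? w
    ... | yes Ew = inj₁ (same (stay (unique w u Ew Eu)))
    ... | no ¬Ew = inj₂ (same (joined w v ¬Ew ¬Ev))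

    isolated : ∀ {x} → Walk X u x → u ≈ x
    isolated {x} ux with E? x
    ... | yes Ex = unique u x Eu Ex
    ... | no ¬Ex = contradiction (Walk-trans ux (joined x v ¬Ex ¬Ev)) ¬uv

  -- `E` is a predicate, possibly empty, because the exceptional vertex may itself have been
  -- deleted. The ends of the disconnected pair cannot both lie in `E` nor both outside it, so one
  -- of them is the isolated vertex.
  twoComponents : ∀ {p} (E : Pred Vertex p) → Decidable E →
                  (∀ x y → E x → E y → x ≈ y) →
                  (∀ x y → ¬ E x → ¬ E y → Walk X x y) →
                  Disconnected X → ExactlyTwoComponentsOneIsolated X
  twoComponents E E? unique joined (u , v , ¬uv) with E? u | E? v
  ... | yes Eu | yes Ev = contradiction (stay (unique u v Eu Ev)) ¬uv
  ... | no ¬Eu | no ¬Ev = contradiction (joined u v ¬Eu ¬Ev) ¬uv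
  ... | yes Eu | no ¬Ev = componentsOfIsolated E E? unique joined u v Eu ¬Ev ¬uv
  ... | no ¬Eu | yes Ev =
    componentsOfIsolated E E? unique joined v u Ev ¬Eu (λ vu → ¬uv (Walk-sym vu))

-- Pigeonhole and counting in lists.

missing : ∀ {n} (f : Fin n → ℕ) → (∀ {i j} → f i ≡ f j → i ≡ j) →
          (xs : List ℕ) → length xs < n → ∃ λ i → ¬ (f i ∈ xs)
missing {n} f f-inj xs xs<n =
  Fin.¬∀⟶∃¬ n (λ i → f i ∈ xs) (λ i → f i ∈? xs) λ all →
    -- If every value occurred, their positions would inject `Fin n` into the shorter `xs`.
    contradiction (Fin.injective⇒≤ {f = λ i → Any.index (all i)} (λ {i} {j} eq →
      f-inj (index-injective (setoid ℕ) (all i) (all j) eq))) (<⇒≱ xs<n)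

length-filter-¬ : ∀ {a p} {A : Set a} {P : Pred A p} (P? : Decidable P) (xs : List A) →
                  length (filter P? xs) + length (filter (λ x → ¬? (P? x)) xs) ≡ length xs
length-filter-¬ P? []       = refl
length-filter-¬ P? (x ∷ xs) with P? x
... | yes _ = cong suc (length-filter-¬ P? xs)
... | no  _ = trans (+-suc _ _) (cong suc (length-filter-¬ P? xs))

-- Recovers j from x r_j and from x r_j r_q: here P is the index of c in x, and
-- s and t are the indices of c and of x(0) in the given permutation.
decode : ℕ → ℕ → ℕ → ℕ
decode P (suc s) t = suc t
decode P zero    t with t <? P
... | yes _ = suc P ∸ t
... | no  _ = suc t

decode-< : ∀ {P t} → t < P → decode P 0 t ≡ suc P ∸ t
decode-< {P} {t} t<P with t <? P
... | yes _   = refl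
... | no  t≮P = contradiction t<P t≮P

decode-≮ : ∀ {P} s {t} → ¬ t < P → decode P s t ≡ suc t
decode-≮         (suc s)     t≮P = refl
decode-≮ {P}     zero    {t} t≮P with t <? P
... | yes t<P = contradiction t<P t≮P
... | no  _   = refl

decode-≢0 : ∀ {P s t} → s ≢ 0 → decode P s t ≡ suc t
decode-≢0 {s = zero}  s≢0 = contradiction refl s≢0
decode-≢0 {s = suc _} s≢0 = refl

reversePrefix-cong : ∀ {n i j} (i≤n : i ≤ n) (j≤n : j ≤ n) → i ≡ j →
                     ∀ k → reversePrefix i i≤n k ≡ reversePrefix j j≤n k
reversePrefix-cong i≤n j≤n refl k = cong (λ p → reversePrefix _ p k) (≤-irrelevant i≤n j≤n)

-- Prefix reversals acting on positions and values.

module _ (m : ℕ) where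

  private
    S : Setoid _ _
    S = Group.setoid (SymmetricGroup (suc m))

    open Membership S using () renaming (_∈_ to _∈′_)

    Vertex′ : Set
    Vertex′ = Permutation′ (suc m)

  last : Fin (suc m)
  last = fromℕ m

  toℕ≥m⇒last : ∀ i → m ≤ toℕ i → i ≡ last
  toℕ≥m⇒last i m≤i = Fin.toℕ-injective
    (trans (≤-antisym (Fin.toℕ≤pred[n] i) m≤i) (sym (Fin.toℕ-fromℕ m)))

  -- The product g r_j, since `_∘ₚ_` applies its left factor first. The values 0 and 1 of j give g
  -- itself and are no generators.
  rev : ∀ j → j ≤ suc m → Vertex′ → Vertex′
  rev j j≤n g = prefixReversal j j≤n ∘ₚ g

  rev-last : ∀ j (j≤m : j ≤ m) g → rev j (m≤n⇒m≤1+n j≤m) g ⟨$⟩ʳ last ≡ g ⟨$⟩ʳ last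
  rev-last j j≤m g = cong (g ⟨$⟩ʳ_) (reversePrefix-≮ j (m≤n⇒m≤1+n j≤m) last
    (λ l<j → <⇒≱ (subst (_< j) (Fin.toℕ-fromℕ m) l<j) j≤m))

  full : suc m ≤ suc m
  full = ≤-refl

  rev-full-last : ∀ g → rev (suc m) full g ⟨$⟩ʳ last ≡ g ⟨$⟩ʳ zero
  rev-full-last g = cong (g ⟨$⟩ʳ_) (Fin.toℕ-injective (trans
    (reversePrefix-< (suc m) full last (Fin.toℕ<n last))
    (trans (cong (m ∸_) (Fin.toℕ-fromℕ m)) (n∸n≡0 m))))

  ⟨$⟩ʳ-injective : ∀ (g : Vertex′) {i j} → g ⟨$⟩ʳ i ≡ g ⟨$⟩ʳ j → i ≡ j
  ⟨$⟩ʳ-injective g {i} {j} eq =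
    trans (sym (inverseˡ g)) (trans (cong (g ⟨$⟩ˡ_) eq) (inverseˡ g))

  ⟨$⟩ˡ-cong : ∀ {g h : Vertex′} → g Perm.≈ h → ∀ v → g ⟨$⟩ˡ v ≡ h ⟨$⟩ˡ v
  ⟨$⟩ˡ-cong {g} {h} = Group.⁻¹-cong (SymmetricGroup (suc m)) {g} {h}

  endsIn? : ∀ i → Decidable (λ (g : Vertex′) → g ⟨$⟩ʳ last ≡ i)
  endsIn? i g = g ⟨$⟩ʳ last Fin.≟ i

  index : Fin (suc m) → Vertex′ → ℕ
  index v g = toℕ (g ⟨$⟩ˡ v)

  -- In the inverse of g r_j the reversal is the outer map, so it acts directly on the position of a
  -- value.
  index-rev-< : ∀ v j j≤n g → index v g < j → index v (rev j j≤n g) ≡ j ∸ suc (index v g)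
  index-rev-< v j j≤n g = reversePrefix-< j j≤n (g ⟨$⟩ˡ v)

  index-rev-≮ : ∀ v j j≤n g → ¬ index v g < j → index v (rev j j≤n g) ≡ index v g
  index-rev-≮ v j j≤n g i≮j = cong toℕ (reversePrefix-≮ j j≤n (g ⟨$⟩ˡ v) i≮j)

  index-0 : ∀ v g → index v g ≡ 0 → g ⟨$⟩ʳ zero ≡ v
  index-0 v g eq = trans (cong (g ⟨$⟩ʳ_) (Fin.toℕ-injective (sym eq))) (inverseʳ g)

  -- Connectedness of the copy with last entry `c`.

  module _ (D : VertexSet (Pancake (suc m))) (c : Fin (suc m))
           (clean : ∀ {d} → d ∈′ VertexSet.elements D → d ⟨$⟩ʳ last ≢ c) where

    private
      X : Graph _ _ _
      X = Pancake (suc m) ─ D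

      open Graph X using (Vertex)

      D′ : List Vertex′
      D′ = VertexSet.elements D

    inCopy-∉D : ∀ g → g ⟨$⟩ʳ last ≡ c → ¬ g ∈′ D′
    inCopy-∉D g e g∈D = clean {g} g∈D e

    inCopy : ∀ g → g ⟨$⟩ʳ last ≡ c → Vertex
    inCopy g e = g , inCopy-∉D g e

    step-rev : ∀ j → 2 ≤ j → (j≤n : j ≤ suc m) → ∀ g g∉D r∉D {w} →
               Walk X (rev j j≤n g , r∉D) w → Walk X (g , g∉D) w
    step-rev j 2≤j j≤n g g∉D r∉D =
      step {v = _ , r∉D} (prefixReversal j j≤n , (j , 2≤j , j≤n , λ _ → refl) , λ _ → refl)

    -- Admitting j = 0 and j = 1 as empty walks spares the sorting below a case distinction.
    copyWalk-rev : ∀ j (j≤m : j ≤ m) g (e : g ⟨$⟩ʳ last ≡ c) →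
                   Walk X (inCopy g e)
                          (inCopy (rev j (m≤n⇒m≤1+n j≤m) g) (trans (rev-last j j≤m g) e))
    copyWalk-rev zero j≤m g e =
      stay λ k → cong (g ⟨$⟩ʳ_) (sym (reversePrefix-≮ 0 (m≤n⇒m≤1+n j≤m) k λ ()))
    copyWalk-rev (suc zero) j≤m g e = stay λ k → cong (g ⟨$⟩ʳ_) (sym (fixed k))
      where
      fixed : ∀ k → reversePrefix 1 (m≤n⇒m≤1+n j≤m) k ≡ k
      fixed zero    = Fin.toℕ-injective (reversePrefix-< 1 (m≤n⇒m≤1+n j≤m) zero (s≤s z≤n))
      fixed (suc k) = reversePrefix-≮ 1 (m≤n⇒m≤1+n j≤m) (suc k) (λ { (s≤s ()) })
    copyWalk-rev (suc (suc j)) j≤m g e =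
      step-rev (suc (suc j)) (s≤s (s≤s z≤n)) _ g (inCopy-∉D g e)
        (inCopy-∉D (rev (suc (suc j)) _ g) (trans (rev-last (suc (suc j)) j≤m g) e))
        (stay λ _ → refl)

    -- Sorting: two prefix reversals move the value h(k) to index k.
    copyWalk-agree : ∀ k → k ≤ m → ∀ g h (eg : g ⟨$⟩ʳ last ≡ c) (eh : h ⟨$⟩ʳ last ≡ c) →
                     (∀ i → k ≤ toℕ i → g ⟨$⟩ʳ i ≡ h ⟨$⟩ʳ i) →
                     Walk X (inCopy g eg) (inCopy h eh)
    copyWalk-agree zero    _   g h eg eh agree = stay λ i → agree i z≤n
    copyWalk-agree (suc k) k<m g h eg eh agree =
      -- The first reversal brings the value from index `q` to 0, the second carries it to `k`; both
      -- fix all indices above `k`.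
      Walk-trans X (copyWalk-rev (suc q) q<m g eg)
        (Walk-trans X (copyWalk-rev (suc k) k<m g₁ e₁)
          (copyWalk-agree k (<⇒≤ k<m) g₂ h (trans (rev-last (suc k) k<m g₁) e₁) eh agree′))
      where
      kF : Fin (suc m)
      kF = fromℕ< (m≤n⇒m≤1+n k<m)

      toℕ-kF : toℕ kF ≡ k
      toℕ-kF = Fin.toℕ-fromℕ< _

      qF : Fin (suc m)
      qF = g ⟨$⟩ˡ (h ⟨$⟩ʳ kF)

      q : ℕ
      q = toℕ qF

      q≤k : q ≤ k
      -- Above `k` the two agree, so `k < q` would put the value h(k) at index `q` of `h` as well.
      q≤k = ≮⇒≥ λ k<q → <⇒≢ k<q (trans (sym toℕ-kF) (cong toℕ (⟨$⟩ʳ-injective h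
        (trans (sym (inverseʳ g)) (agree qF k<q)))))

      q<m : suc q ≤ m
      q<m = ≤-trans (s≤s q≤k) k<m

      g₁ g₂ : Vertex′
      g₁ = rev (suc q) (m≤n⇒m≤1+n q<m) g
      g₂ = rev (suc k) (m≤n⇒m≤1+n k<m) g₁

      e₁ : g₁ ⟨$⟩ʳ last ≡ c
      e₁ = trans (rev-last (suc q) q<m g) eg

      r₁ r₂ : Fin (suc m) → Fin (suc m)
      r₁ = reversePrefix (suc q) (m≤n⇒m≤1+n q<m)
      r₂ = reversePrefix (suc k) (m≤n⇒m≤1+n k<m)

      agree′ : ∀ i → k ≤ toℕ i → g₂ ⟨$⟩ʳ i ≡ h ⟨$⟩ʳ i
      agree′ i k≤i with k ≟ toℕ i
      ... | yes k≡i = trans (cong (g ⟨$⟩ʳ_) r₁r₂i)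
                        (trans (inverseʳ g) (cong (h ⟨$⟩ʳ_) (Fin.toℕ-injective (trans toℕ-kF k≡i))))
        where
        r₂i : toℕ (r₂ i) ≡ 0
        r₂i = trans (reversePrefix-< (suc k) _ i (s≤s (≤-reflexive (sym k≡i))))
                (trans (cong (k ∸_) (sym k≡i)) (n∸n≡0 k))

        r₁r₂i : r₁ (r₂ i) ≡ qF
        r₁r₂i = Fin.toℕ-injective
          (trans (reversePrefix-< (suc q) _ (r₂ i) (subst (_< suc q) (sym r₂i) (s≤s z≤n)))
            (cong (q ∸_) r₂i))
      ... | no  k≢i = trans (cong (g ⟨$⟩ʳ_) (trans (cong r₁ r₂i) r₁i)) (agree i k<i)
        where
        k<i : k < toℕ i
        k<i = ≤∧≢⇒< k≤i k≢i

        r₂i : r₂ i ≡ i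
        r₂i = reversePrefix-≮ (suc k) _ i (≤⇒≯ k<i)

        r₁i : r₁ i ≡ i
        r₁i = reversePrefix-≮ (suc q) _ i (≤⇒≯ (≤-trans (s≤s q≤k) k<i))

    copyWalk : ∀ g h (eg : g ⟨$⟩ʳ last ≡ c) (eh : h ⟨$⟩ʳ last ≡ c) →
               Walk X (inCopy g eg) (inCopy h eh)
    copyWalk g h eg eh = copyWalk-agree m ≤-refl g h eg eh λ i m≤i →
      subst (λ k → g ⟨$⟩ʳ k ≡ h ⟨$⟩ʳ k) (sym (toℕ≥m⇒last i m≤i)) (trans eg (sym eh))

    -- The end point is left existential: the copy is connected, so any of its vertices will do.
    Joined : Vertex → Set
    Joined x = Σ Vertex′ λ g → Σ (g ⟨$⟩ʳ last ≡ c) λ e → Walk X x (inCopy g e)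

    Joined⇒Walk : ∀ {x y} → Joined x → Joined y → Walk X x y
    Joined⇒Walk (g , eg , xg) (h , eh , yh) =
      Walk-trans X xg (Walk-trans X (copyWalk g h eg eh) (Walk-sym X yh))

    Joined-rev : ∀ j → 2 ≤ j → (j≤n : j ≤ suc m) → ∀ x x∉D y∉D →
                 Joined (rev j j≤n x , y∉D) → Joined (x , x∉D)
    Joined-rev j 2≤j j≤n x x∉D y∉D (g , e , w) =
      g , e , step-rev j 2≤j j≤n x x∉D y∉D w

    Joined-last : ∀ x x∉D → x ⟨$⟩ʳ last ≡ c → Joined (x , x∉D)
    Joined-last x x∉D e = x , e , stay λ _ → refl

    Joined-front : 1 ≤ m → ∀ x x∉D → index c x ≡ 0 → Joined (x , x∉D)
    Joined-front 1≤m x x∉D e =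
      Joined-rev (suc m) (s≤s 1≤m) full x x∉D (inCopy-∉D y ey) (Joined-last y _ ey)
      where
      y : Vertex′
      y = rev (suc m) full x

      ey : y ⟨$⟩ʳ last ≡ c
      ey = trans (rev-full-last x) (index-0 c x e)

    -- The fan of paths from `x` into copy `c`.

    module Fan (x : Vertex′) (x∉D : ¬ x ∈′ D′) (E : List Vertex′) (E<m∸1 : length E < m ∸ 1)
               (cover : ∀ {d} → d ∈′ D′ → d ⟨$⟩ʳ last ≡ x ⟨$⟩ʳ last → d ∈′ E) where

      P : ℕ
      P = index c x

      first : Fin (suc m)
      first = x ⟨$⟩ʳ zero

      code : Vertex′ → ℕ
      code d = decode P (index c d) (index first d)

      code-cong : ∀ {d e : Vertex′} → d Perm.≈ e → code d ≡ code e
      code-cong {d} {e} d≈e = cong₂ (λ s t → decode P (toℕ s) (toℕ t))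
        (⟨$⟩ˡ-cong {d} {e} d≈e c) (⟨$⟩ˡ-cong {d} {e} d≈e first)

      -- Each element of `E` blocks only the path named by its code. The candidates j = 2, ..., m
      -- number m - 1, more than `E` has elements.
      free : ∃ λ (k : Fin (m ∸ 1)) → ¬ (suc (suc (toℕ k)) ∈ map code E)
      free = missing (λ k → suc (suc (toℕ k)))
        (λ eq → Fin.toℕ-injective (suc-injective (suc-injective eq)))
        (map code E) (subst (_< m ∸ 1) (sym (length-map code E)) E<m∸1)

      k j : ℕ
      k = toℕ (proj₁ free)
      j = suc (suc k)

      k<m∸1 : k < m ∸ 1
      k<m∸1 = Fin.toℕ<n (proj₁ free)

      1≤m : 1 ≤ m
      1≤m = ≤-trans (≤-trans (s≤s z≤n) k<m∸1) (m∸n≤m m 1)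

      j≤m : j ≤ m
      j≤m = m≤pred[n]⇒suc[m]≤n {{>-nonZero 1≤m}} k<m∸1

      avoids : ∀ d → code d ≡ j → d ⟨$⟩ʳ last ≡ x ⟨$⟩ʳ last → ¬ d ∈′ D′
      avoids d code≡j d-last d∈D = proj₂ free (subst (_∈ map code E) code≡j
        (∈-map⁺ S (setoid ℕ) (λ {d} {e} → code-cong {d} {e}) {d} (cover {d} d∈D d-last)))

      y : Vertex′
      y = rev j (m≤n⇒m≤1+n j≤m) x

      first-x : index first x ≡ 0
      first-x = cong toℕ (inverseˡ x)

      first-y : index first y ≡ suc k
      first-y = trans (index-rev-< first j _ x (subst (_< j) (sym first-x) (s≤s z≤n)))
        (cong (λ i → j ∸ suc i) first-x)

      Joined-y : code y ≡ j → (∀ y∉D → Joined (y , y∉D)) → Joined (x , x∉D)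
      Joined-y code-y joined = Joined-rev j (s≤s (s≤s z≤n)) _ x x∉D y∉D (joined y∉D)
        where
        y∉D : ¬ y ∈′ D′
        y∉D = avoids y code-y (rev-last j j≤m x)

      -- `1≤q` makes the second reversal a generator, and `q<m` keeps it from moving the last entry,
      -- so `z` stays in the copy of `x`.
      module Long (q : ℕ) (c-y : index c y ≡ q) (1≤q : 1 ≤ q) (q<m : suc q ≤ m) where

        z : Vertex′
        z = rev (suc q) (m≤n⇒m≤1+n q<m) y

        c-z : index c z ≡ 0
        c-z = trans (index-rev-< c (suc q) _ y (s≤s (≤-reflexive c-y)))
          (trans (cong (q ∸_) c-y) (n∸n≡0 q))

        code-z : ∀ {t} → index first z ≡ t → code z ≡ decode P 0 t
        code-z = cong₂ (decode P) c-z

        Joined-long : code z ≡ j → ∀ y∉D → Joined (y , y∉D)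
        Joined-long code≡j y∉D = Joined-rev (suc q) (s≤s 1≤q) _ y y∉D z∉D (Joined-front 1≤m z z∉D c-z)
          where
          z∉D : ¬ z ∈′ D′
          z∉D = avoids z code≡j (trans (rev-last (suc q) q<m y) (rev-last j j≤m x))

      code-y-≮ : ¬ suc k < P → code y ≡ j
      code-y-≮ k≮P = trans (cong (decode P (index c y)) first-y) (decode-≮ (index c y) k≮P)

      joined : P ≢ 0 → P ≢ m → Joined (x , x∉D)
      joined P≢0 P≢m with <-cmp P (suc k)
      -- j = k + 2 reverses the indices 0 to k + 1. Here `c` sits at the last of these and comes to
      -- the front at once.
      ... | tri≈ _ P≡1+k _ = Joined-y (code-y-≮ (≤⇒≯ (≤-reflexive P≡1+k)))
          λ y∉D → Joined-front 1≤m y y∉D c-y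
        where
        c-y : index c y ≡ 0
        c-y = trans (index-rev-< c j _ x (s≤s (≤-reflexive P≡1+k)))
          (trans (cong (suc k ∸_) P≡1+k) (n∸n≡0 (suc k)))
      -- `c` moves to index k + 1 - P, at most k, so the second reversal leaves x(0) at k + 1.
      ... | tri< P<1+k _ _ =
          Joined-y (code-y-≮ k≮P) (Joined-long (trans (code-z first-z) (decode-≮ 0 k≮P)))
        where
        k≮P : ¬ suc k < P
        k≮P = <-asym P<1+k

        q≤k : suc k ∸ P ≤ k
        q≤k = ∸-monoʳ-≤ (suc k) (n≢0⇒n>0 P≢0)

        open Long (suc k ∸ P) (index-rev-< c j _ x (m≤n⇒m≤1+n P<1+k)) (m<n⇒0<n∸m P<1+k)
          (≤-trans (s≤s q≤k) (<⇒≤ j≤m))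

        first-z : index first z ≡ suc k
        first-z = trans (index-rev-≮ first _ _ y
          (λ 1+k<1+q → ≤⇒≯ q≤k (≤-pred (subst (_< suc (suc k ∸ P)) first-y 1+k<1+q)))) first-y
      -- `c` stays at P, and the second reversal carries x(0) from k + 1 to P - (k + 1). This is
      -- below P, so `decode` takes its subtracting branch.
      ... | tri> _ _ 1+k<P = Joined-y code-y (Joined-long (trans (code-z first-z) decode≡j))
        where
        c-y : index c y ≡ P
        c-y = index-rev-≮ c j _ x (≤⇒≯ 1+k<P)

        P<m : P < m
        P<m = ≤∧≢⇒< (Fin.toℕ≤pred[n] (x ⟨$⟩ˡ c)) P≢m

        open Long P c-y (n≢0⇒n>0 P≢0) P<m

        code-y : code y ≡ j
        code-y = trans (cong₂ (decode P) c-y first-y) (decode-≢0 P≢0)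

        first-z : index first z ≡ P ∸ suc k
        first-z = trans (index-rev-< first _ _ y (subst (_< suc P) (sym first-y) (m≤n⇒m≤1+n 1+k<P)))
          (cong (P ∸_) first-y)

        decode≡j : decode P 0 (P ∸ suc k) ≡ j
        decode≡j = trans (decode-< (∸-monoʳ-< {P} {suc k} {0} (s≤s z≤n) (<⇒≤ 1+k<P)))
          (trans (+-∸-assoc 1 (m∸n≤m P (suc k))) (cong suc (m∸[m∸n]≡n (<⇒≤ 1+k<P))))

    Joined-fan : 1 ≤ m → ∀ x x∉D E → length E < m ∸ 1 →
                 (∀ {d} → d ∈′ D′ → d ⟨$⟩ʳ last ≡ x ⟨$⟩ʳ last → d ∈′ E) → Joined (x , x∉D)
    Joined-fan 1≤m x x∉D E E<m∸1 cover with index c x ≟ 0 | index c x ≟ m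
    ... | yes P≡0 | _ = Joined-front 1≤m x x∉D P≡0
    ... | no  _   | yes P≡m = Joined-last x x∉D
      (trans (cong (x ⟨$⟩ʳ_) (sym (toℕ≥m⇒last _ (≤-reflexive (sym P≡m))))) (inverseʳ x))
    ... | no  P≢0 | no  P≢m = Fan.joined x x∉D E E<m∸1 (λ {d} → cover {d}) P≢0 P≢m

    -- All vertices but one are joined to copy `c`.

    allButOne : 3 ≤ m → length D′ ≤ m →
                Σ Vertex′ λ w → ∀ x x∉D → ¬ x Perm.≈ w → Joined (x , x∉D)
    allButOne 3≤m D≤m with Fin.any? (λ i → m ∸ 1 ≤? length (filter (endsIn? i) D′))
    -- No copy holds m - 1 elements of `D`, so the fan joins every vertex; `Perm.id` is a default.
    ... | no small = Perm.id , λ x x∉D _ →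
      Joined-fan (≤-trans (s≤s z≤n) 3≤m) x x∉D _ (≰⇒> λ big → small (x ⟨$⟩ʳ last , big))
        λ {d} → ∈-filter⁺ S (endsIn? (x ⟨$⟩ʳ last))
          (λ d≈e d-last → trans (sym (d≈e last)) d-last) {d}
    ... | yes (i , big) = exception outside , joined
      where
      outside : List Vertex′
      outside = filter (λ d → ¬? (endsIn? i d)) D′

      outside≤1 : length outside ≤ 1
      outside≤1 = +-cancelˡ-≤ (m ∸ 1) _ _ (begin
        m ∸ 1 + length outside ≤⟨ +-monoˡ-≤ _ big ⟩
        length (filter (endsIn? i) D′) + length outside
          ≡⟨ length-filter-¬ (endsIn? i) D′ ⟩
        length D′              ≤⟨ D≤m ⟩
        m                      ≡⟨ m∸n+n≡m (≤-trans (s≤s z≤n) 3≤m) ⟨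
        m ∸ 1 + 1              ∎)
        where open ≤-Reasoning

      ∈-outside : ∀ {d} → d ∈′ D′ → d ⟨$⟩ʳ last ≢ i → d ∈′ outside
      ∈-outside {d} = ∈-filter⁺ S (λ d → ¬? (endsIn? i d))
        (λ d≈e d-last e-last → d-last (trans (d≈e last) e-last)) {d}

      -- Full reversal is an involution, so d r_n is the only vertex that it carries to d. The empty
      -- list gets a default.
      exception : List Vertex′ → Vertex′
      exception []      = Perm.id
      exception (d ∷ _) = rev (suc m) full d

      ∈⇒exception : ∀ {x} ds → length ds ≤ 1 → rev (suc m) full x ∈′ ds → x Perm.≈ exception ds
      ∈⇒exception {x} (d ∷ []) _ (here rx≈d) k =
        trans (cong (x ⟨$⟩ʳ_) (sym (reversePrefix-involutive (suc m) full k))) (rx≈d _)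
      ∈⇒exception (_ ∷ _ ∷ _) (s≤s ()) _

      joined-outside : ∀ x x∉D → x ⟨$⟩ʳ last ≢ i → Joined (x , x∉D)
      joined-outside x x∉D x-last = Joined-fan (≤-trans (s≤s z≤n) 3≤m) x x∉D outside
        -- At most one path is blocked, and 1 < m - 1 because m is at least 3, that is, n is at
        -- least 4.
        (≤-<-trans outside≤1 (∸-monoˡ-≤ 1 3≤m))
        λ {d} d∈D d-last → ∈-outside {d} d∈D λ e → x-last (trans (sym d-last) e)

      joined : ∀ x x∉D → ¬ x Perm.≈ exception outside → Joined (x , x∉D)
      joined x x∉D x≉w with x ⟨$⟩ʳ last Fin.≟ i
      ... | no  x-last = joined-outside x x∉D x-last
      ... | yes x-last =
        Joined-rev (suc m) (s≤s (≤-trans (s≤s z≤n) 3≤m)) full x x∉D y∉D (joined-outside y y∉D y-last)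
        where
        y : Vertex′
        y = rev (suc m) full x

        y-last : y ⟨$⟩ʳ last ≢ i
        y-last e = <⇒≢ (≤-trans (s≤s z≤n) 3≤m) (trans
          (cong toℕ (⟨$⟩ʳ-injective x (trans (sym (rev-full-last x)) (trans e (sym x-last)))))
          (Fin.toℕ-fromℕ m))

        y∉D : ¬ y ∈′ D′
        y∉D y∈D = x≉w (∈⇒exception {x} outside outside≤1 (∈-outside {y} y∈D y-last))

  -- The neighbours of the identity as a cut.

  neighbour : Fin m → Vertex′
  neighbour k = prefixReversal (suc (suc (toℕ k))) (s≤s (Fin.toℕ<n k))

  -- r_j sends index 0 to j - 1, which determines j.
  neighbour-injective : ∀ {i j} → neighbour i Perm.≈ neighbour j → i ≡ j
  neighbour-injective {i} {j} eq = Fin.toℕ-injective (suc-injective (trans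
    (sym (reversePrefix-< (suc (suc (toℕ i))) (s≤s (Fin.toℕ<n i)) zero (s≤s z≤n)))
    (trans (cong toℕ (eq zero))
      (reversePrefix-< (suc (suc (toℕ j))) (s≤s (Fin.toℕ<n j)) zero (s≤s z≤n)))))

  neighbours : VertexSet (Pancake (suc m))
  neighbours = record
    { elements = tabulate neighbour
    ; unique   = tabulate⁺ S neighbour-injective
    }

  ∈-neighbours⁺ : ∀ {g} k → g Perm.≈ neighbour k → g ∈′ tabulate neighbour
  ∈-neighbours⁺ {g} k = Any.tabulate⁺ {P = g Perm.≈_} {f = neighbour} k

  ∈-neighbours⁻ : ∀ {g} → g ∈′ tabulate neighbour → ∃ λ k → g Perm.≈ neighbour k
  ∈-neighbours⁻ {g} = Any.tabulate⁻ {P = g Perm.≈_} {f = neighbour}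

  Perm-≈? : (g h : Vertex′) → Dec (g Perm.≈ h)
  Perm-≈? g h = Fin.all? λ k → g ⟨$⟩ʳ k Fin.≟ h ⟨$⟩ʳ k

-- Every step from the identity lands in a deleted vertex. The second vertex must survive the
-- deletion; the deleted ones are involutions, so a non-involution serves.
neighbours-cut : ∀ m → 2 ≤ m → VertexCut (Pancake (suc m)) (neighbours m)
neighbours-cut m@(suc (suc _)) (s≤s (s≤s z≤n)) = u , v , ¬walk
  where
  X : Graph _ _ _
  X = Pancake (suc m) ─ neighbours m

  open Graph X using (Vertex; _≈_)

  -- A 3-cycle, so not an involution.
  g : Permutation′ (suc m)
  g = prefixReversal 2 (s≤s (s≤s z≤n)) ∘ₚ prefixReversal 3 (s≤s (s≤s (s≤s z≤n)))

  g-not-involutive : g ⟨$⟩ʳ (g ⟨$⟩ʳ zero) ≢ zero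
  -- By evaluation, `g` sends 0 to 1 and 1 to 2.
  g-not-involutive ()

  u v : Vertex
  u = Perm.id , λ id∈ → let k , eq = ∈-neighbours⁻ m {Perm.id} id∈ in
    id∉PR (suc m) (_ , s≤s (s≤s z≤n) , s≤s (Fin.toℕ<n k) , eq)
  v = g , λ g∈ → let k , eq = ∈-neighbours⁻ m {g} g∈ in g-not-involutive (trans (eq (g ⟨$⟩ʳ zero))
    (trans (cong (neighbour m k ⟨$⟩ʳ_) (eq zero))
      (reversePrefix-involutive (suc (suc (toℕ k))) (s≤s (Fin.toℕ<n k)) zero)))

  ¬walk : ¬ Walk X u v
  ¬walk (stay u≈v) = g-not-involutive (trans (cong (g ⟨$⟩ʳ_) (sym (u≈v zero))) (sym (u≈v zero)))
  ¬walk (step {v = w} (s , (suc (suc j) , s≤s (s≤s z≤n) , s≤s j<m , s≈r) , w≈s) _) =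
    proj₂ w (∈-neighbours⁺ m {proj₁ w} (fromℕ< j<m) λ i → trans (w≈s i) (trans (s≈r i) (r≈ i)))
    where
    r≈ : prefixReversal (suc (suc j)) (s≤s j<m) Perm.≈ neighbour m (fromℕ< j<m)
    r≈ = reversePrefix-cong _ _ (cong (λ k → suc (suc k)) (sym (Fin.toℕ-fromℕ< j<m)))

theorem2p5 : ∀ (n : ℕ) → 4 ≤ n → HyperConnected (Pancake n)
theorem2p5 (suc m) (s≤s 3≤m) D (cut , minimum) =
  -- There are m + 1 possible last entries and at most m elements of `D`.
  let c , c-missing = missing toℕ Fin.toℕ-injective (map lastℕ (elements D))
        (subst (_< suc m) (sym (length-map lastℕ (elements D))) (s≤s D≤m))
      w , joined = allButOne m D c
        (λ {d} d∈D e → c-missing (subst (_∈ map lastℕ (elements D)) (cong toℕ e)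
          (∈-map⁺ (Group.setoid (SymmetricGroup (suc m))) (setoid ℕ)
            (λ eq → cong toℕ (eq (last m))) {d} d∈D)))
        3≤m D≤m
  in twoComponents (Pancake (suc m) ─ D) (λ x → proj₁ x Perm.≈ w) (λ x → Perm-≈? m (proj₁ x) w)
       (λ _ _ x≈w y≈w k → trans (x≈w k) (sym (y≈w k)))
       (λ x y x≉w y≉w → Joined⇒Walk m D c _ (joined (proj₁ x) (proj₂ x) x≉w)
                                            (joined (proj₁ y) (proj₂ y) y≉w))
       cut
  where
  open VertexSet using (elements; card)

  lastℕ : Permutation′ (suc m) → ℕ
  lastℕ g = toℕ (g ⟨$⟩ʳ last m)

  D≤m : card D ≤ m
  D≤m = subst (card D ≤_) (length-tabulate (neighbour m))
    (minimum (neighbours m) (neighbours-cut m (<⇒≤ 3≤m)))
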